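{- Let $k$ and $a_n$ be integers with $a_n\ge k-1\ge 2$, and let $n=a_nk$. Then $src^*(C_n(\{1,k\})) = rc^*(C_n(\{1,k\})) = a_n+k-2$.
   Context: For an integer $n\ge 2$ and $S\subseteq\{1,\dots,n-1\}$, the circulant digraph $C_n(S)$ has vertex set $\{v_0,\dots,v_{n-1}\}$ and arcs $v_iv_j$ whenever $j-i\equiv s \pmod n$ for some $s\in S$. For an arc-colouring of a strongly connected digraph $D$, a directed path is rainbow if no two of its arcs have the same colour. $rc^*(D)$ is the minimum number of colours in an arc-colouring such that for every ordered pair of distinct vertices $x,y$ there is a rainbow directed $xy$-path. $src^*(D)$ is the minimum number of colours in an arc-colouring such that for every ordered pair of distinct vertices $x,y$ there is a rainbow directed $xy$-path of length equal to the directed distance $d_D(x,y)$. -}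

module Defs where

open import Data.Nat using (ℕ; zero; suc; _+_; _*_; _<_; _≤_; _∸_)
open import Data.Fin using (Fin; toℕ)
open import Data.List using (List; []; _∷_)
open import Data.List.Relation.Unary.Any using (Any)
open import Data.List.Relation.Unary.Unique.Propositional using (Unique)
open import Data.Product using (Σ; ∃; _×_; _,_)
open import Relation.Binary.PropositionalEquality using (_≡_; _≢_)
open import Relation.Nullary using (¬_)

Digraph : ℕ → Set₁
Digraph n = Fin n → Fin n → Set

-- Circulant digraph C_n(S), S given as a list of naturals:
-- arc v_i v_j iff j - i ≡ s (mod n) for some s ∈ S, i.e. i + s ≡ j + q n for some q.
Circulant : (n : ℕ) → List ℕ → Digraph n
Circulant n S i j = Any (λ s → ∃ λ q → toℕ i + s ≡ toℕ j + q * n) S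

data Walk {n : ℕ} (D : Digraph n) : Fin n → Fin n → Set where
  []  : ∀ {x} → Walk D x x
  _∷_ : ∀ {x y z} → D x y → Walk D y z → Walk D x z

module _ {n : ℕ} {D : Digraph n} where

  len : ∀ {x y} → Walk D x y → ℕ
  len []      = 0
  len (_ ∷ w) = suc (len w)

  vertices : ∀ {x y} → Walk D x y → List (Fin n)
  vertices {x} []      = x ∷ []
  vertices {x} (_ ∷ w) = x ∷ vertices w

  -- colours of the arcs traversed, under an arc-colouring given as a
  -- function on ordered vertex pairs (only its values on arcs matter)
  arcColours : ∀ {c x y} → (Fin n → Fin n → Fin c) → Walk D x y → List (Fin c)
  arcColours f []              = []
  arcColours {x = x} f (_∷_ {y = y} _ w) = f x y ∷ arcColours f w

IsPath : ∀ {n} {D : Digraph n} {x y} → Walk D x y → Set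
IsPath w = Unique (vertices w)

IsRainbow : ∀ {n c} {D : Digraph n} {x y} → (Fin n → Fin n → Fin c) → Walk D x y → Set
IsRainbow f w = Unique (arcColours f w)

Distance : ∀ {n} (D : Digraph n) → Fin n → Fin n → ℕ → Set
Distance D x y ℓ =
  (Σ (Walk D x y) λ w → IsPath w × len w ≡ ℓ)
  × (∀ (w : Walk D x y) → IsPath w → ℓ ≤ len w)

StronglyConnected : ∀ {n} → Digraph n → Set
StronglyConnected {n} D = ∀ (x y : Fin n) → Σ (Walk D x y) IsPath

RainbowConnected : ∀ {n} → Digraph n → ℕ → Set
RainbowConnected {n} D c =
  Σ (Fin n → Fin n → Fin c) λ f →
    ∀ (x y : Fin n) → x ≢ y →
      Σ (Walk D x y) λ w → IsPath w × IsRainbow f w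

StronglyRainbowConnected : ∀ {n} → Digraph n → ℕ → Set
StronglyRainbowConnected {n} D c =
  Σ (Fin n → Fin n → Fin c) λ f →
    ∀ (x y : Fin n) → x ≢ y →
      Σ (Walk D x y) λ w → IsPath w × IsRainbow f w × Distance D x y (len w)

rc*≡ : ∀ {n} → Digraph n → ℕ → Set
rc*≡ D m = RainbowConnected D m × (∀ c → c < m → ¬ RainbowConnected D c)

src*≡ : ∀ {n} → Digraph n → ℕ → Set
src*≡ D m = StronglyRainbowConnected D m × (∀ c → c < m → ¬ StronglyRainbowConnected D c)

{-# OPTIONS --safe #-}
-- Write n = a k and arrange the vertices in rows i < a and columns j < k, the vertex
-- i k + j being (i , j). If the displacement from x to y is q k + r with r < k, then the
-- distance is q + r: trading a jump for units or going round again only costs more. The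
-- diameter (a - 1) + (k - 1) is therefore a lower bound for both invariants.
--
-- For the upper bound use "row" colours 0 .. a - 1 and "base" colours a .. a + k - 3.
-- A jump leaving row i gets colour i. The unit arcs, read in cyclic order, repeat a block
-- of length k - 1 made of the k - 2 base colours and one row colour. The first k - 1 rows
-- contain exactly k blocks (this is where a ≥ k - 1 is needed), so every later row can
-- start a new block and has one surplus arc, which receives the next row's colour.
-- Any k - 1 consecutive unit arcs are then rainbow. Jumps first and units last is a rainbow
-- geodesic as long as the units do not cross into the next row or q < a - 1. If they do
-- cross and q = a - 1, all units are taken in a row whose own colour is the only row
-- colour met: crossing means that this is just the row in which no jump is made.
module Submission where

open import Defs
open import Data.Nat
open import Data.Nat.Properties
open import Data.Nat.DivMod
open import Data.Nat.Divisibility using (n∣m*n)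
open import Data.Nat.Tactic.RingSolver using (solve-∀)
open import Data.Empty using (⊥; ⊥-elim)
open import Data.Fin using (Fin; zero; suc; toℕ; fromℕ<)
open import Data.Fin.Properties using (toℕ<n; toℕ-fromℕ<; toℕ-injective; injective⇒≤)
open import Data.List using (List; []; _∷_; _++_; map; replicate; applyUpTo; length; lookup)
open import Data.List.Properties using (length-++; length-replicate)
open import Data.List.Membership.Propositional using (_∈_)
open import Data.List.Membership.Propositional.Properties using (∈-applyUpTo⁻; ∈-++⁻; ∈-lookup)
open import Data.List.Relation.Unary.All as All using (All; []; _∷_)
open import Data.List.Relation.Unary.AllPairs using ([]; _∷_)
open import Data.List.Relation.Unary.Any using (here; there)
open import Data.List.Relation.Unary.Unique.Propositional using (Unique)
open import Data.List.Relation.Unary.Unique.Propositional.Properties using (applyUpTo⁺₁; ++⁺; map⁻)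
open import Data.Product using (Σ; ∃; ∃₂; _×_; _,_)
open import Data.Sum using (_⊎_; inj₁; inj₂; [_,_]′)
open import Relation.Binary.Definitions using (tri<; tri≈; tri>)
open import Relation.Binary.PropositionalEquality
open import Relation.Nullary using (¬_; yes; no; contradiction)

-- Remainders, and the cost of a displacement.

split-≤ : ∀ {x y} → x ≤ y → ∃ λ z → y ≡ x + z
split-≤ x≤y = _ , sym (m+[n∸m]≡n x≤y)

-- Equal remainders would make the difference a multiple of `N`, although it lies strictly between 0
-- and `N`.
%-≢ : ∀ N .{{_ : NonZero N}} {x y} → x < y → y < x + N → x % N ≢ y % N
%-≢ N {x} x<y y<x+N eq with split-≤ (<⇒≤ x<y)
... | δ , refl = <⇒≢ (m<m+n⁻ x<y) (sym δ≡0)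
  where
  m<m+n⁻ : x < x + δ → 0 < δ
  m<m+n⁻ lt = +-cancelˡ-< x 0 δ (subst (_< x + δ) (sym (+-identityʳ x)) lt)

  sums : δ + (x / N) * N ≡ ((x + δ) / N) * N
  sums = +-cancelˡ-≡ (x % N) _ _ (begin
    x % N + (δ + x / N * N)              ≡⟨ swap (x % N) δ (x / N * N) ⟩
    (x % N + x / N * N) + δ              ≡⟨ cong (_+ δ) (m≡m%n+[m/n]*n x N) ⟨
    x + δ                                ≡⟨ m≡m%n+[m/n]*n (x + δ) N ⟩
    (x + δ) % N + (x + δ) / N * N        ≡⟨ cong (_+ (x + δ) / N * N) eq ⟨
    x % N + (x + δ) / N * N              ∎)
    where
    open ≡-Reasoning
    swap : ∀ u v w → u + (v + w) ≡ (u + w) + v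
    swap = solve-∀

  δ≡0 : δ ≡ 0
  δ≡0 = begin
    δ                           ≡⟨ m<n⇒m%n≡m (+-cancelˡ-< x δ N y<x+N) ⟨
    δ % N                       ≡⟨ [m+kn]%n≡m%n δ (x / N) N ⟨
    (δ + x / N * N) % N         ≡⟨ cong (_% N) sums ⟩
    ((x + δ) / N * N) % N       ≡⟨ m*n%n≡0 ((x + δ) / N) N ⟩
    0                           ∎
    where open ≡-Reasoning

suc-%-% : ∀ s N .{{_ : NonZero N}} → suc (s % N) % N ≡ suc s % N
suc-%-% s N = begin
  suc (s % N) % N                   ≡⟨ [m+kn]%n≡m%n (suc (s % N)) (s / N) N ⟨
  (suc (s % N) + s / N * N) % N     ≡⟨ cong (λ z → suc z % N) (m≡m%n+[m/n]*n s N) ⟨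
  suc s % N                         ∎
  where open ≡-Reasoning

[i*k+j]/k≡i : ∀ i {j} k .{{_ : NonZero k}} → j < k → (i * k + j) / k ≡ i
[i*k+j]/k≡i i {j} k j<k = begin
  (i * k + j) / k        ≡⟨ +-distrib-/ (i * k) j small ⟩
  i * k / k + j / k      ≡⟨ cong₂ _+_ (m*n/n≡m i k) (m<n⇒m/n≡0 j<k) ⟩
  i + 0                  ≡⟨ +-identityʳ i ⟩
  i                      ∎
  where
  open ≡-Reasoning
  small : i * k % k + j % k < k
  small = subst (λ z → z + j % k < k) (sym (m*n%n≡0 i k)) (m%n<n j k)

[i*k+j]%k≡j : ∀ i {j} k .{{_ : NonZero k}} → j < k → (i * k + j) % k ≡ j
[i*k+j]%k≡j i {j} k j<k = begin
  (i * k + j) % k   ≡⟨ cong (_% k) (+-comm (i * k) j) ⟩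
  (j + i * k) % k   ≡⟨ [m+kn]%n≡m%n j i k ⟩
  j % k             ≡⟨ m<n⇒m%n≡m j<k ⟩
  j                 ∎
  where open ≡-Reasoning

-- As `r < k` rules out `X > q`, the count `X` falls short of `q` by some `t ≥ 0`, and each of these
-- `t` missing jumps is paid for by `k ≥ 1` units in `Y`.
≤-div-mod-cost : ∀ k .{{_ : NonZero k}} X Y q r → r < k → X * k + Y ≡ q * k + r → q + r ≤ X + Y
≤-div-mod-cost k@(suc k-1) X Y q r r<k eq with X ≤? q
... | yes X≤q with split-≤ X≤q
...   | t , refl = begin
    (X + t) + r            ≡⟨ +-assoc X t r ⟩
    X + (t + r)            ≤⟨ +-monoʳ-≤ X (+-monoˡ-≤ r (m≤m*n t k)) ⟩
    X + (t * k + r)        ≡⟨ cong (X +_) Y≡ ⟨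
    X + Y                  ∎
  where
  open ≤-Reasoning
  regroup : ∀ X t k r → (X + t) * k + r ≡ X * k + (t * k + r)
  regroup = solve-∀
  Y≡ : Y ≡ t * k + r
  Y≡ = +-cancelˡ-≡ (X * k) _ _ (trans eq (regroup X t k r))
≤-div-mod-cost k@(suc k-1) X Y q r r<k eq | no X≰q = contradiction eq (>⇒≢ (begin-strict
    q * k + r      <⟨ +-monoʳ-< (q * k) r<k ⟩
    q * k + k      ≡⟨ +-comm (q * k) k ⟩
    suc q * k      ≤⟨ *-monoˡ-≤ k (≰⇒> X≰q) ⟩
    X * k          ≤⟨ m≤m+n (X * k) Y ⟩
    X * k + Y      ∎))
  where open ≤-Reasoning

%-+-% : ∀ x y N .{{_ : NonZero N}} → (x % N + y) % N ≡ (x + y) % N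
%-+-% x y N = begin
  (x % N + y) % N               ≡⟨ %-distribˡ-+ (x % N) y N ⟩
  (x % N % N + y % N) % N       ≡⟨ cong (λ z → (z + y % N) % N) (m%n%n≡m%n x N) ⟩
  (x % N + y % N) % N           ≡⟨ %-distribˡ-+ x y N ⟨
  (x + y) % N                   ∎
  where open ≡-Reasoning

-- This chooses how many jumps precede the units, so that the units are taken in a prescribed row.
%-reach : ∀ N .{{_ : NonZero N}} x {y} → y < N → ∃ λ z → z < N × (x + z) % N ≡ y
%-reach N x {y} y<N = (y + (N ∸ x % N)) % N , m%n<n (y + (N ∸ x % N)) N , (begin
  (x + (y + (N ∸ x % N)) % N) % N    ≡⟨ cong (_% N) (+-comm x _) ⟩
  ((y + (N ∸ x % N)) % N + x) % N    ≡⟨ %-+-% (y + (N ∸ x % N)) x N ⟩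
  (y + (N ∸ x % N) + x) % N          ≡⟨ cong (_% N) (+-comm _ x) ⟩
  (x + (y + (N ∸ x % N))) % N        ≡⟨ %-+-% x _ N ⟨
  (x % N + (y + (N ∸ x % N))) % N    ≡⟨ cong (_% N) (regroup (x % N) y (N ∸ x % N)) ⟩
  (y + (x % N + (N ∸ x % N))) % N    ≡⟨ cong (λ z → (y + z) % N) (m+[n∸m]≡n (m%n≤n x N)) ⟩
  (y + N) % N                        ≡⟨ [m+n]%n≡m%n y N ⟩
  y % N                              ≡⟨ m<n⇒m%n≡m y<N ⟩
  y                                  ∎)
  where
  open ≡-Reasoning
  regroup : ∀ u v w → u + (v + w) ≡ v + (u + w)
  regroup = solve-∀

-- Pigeonhole for lists of colours.

Unique⇒lookup-injective : ∀ {A : Set} {xs : List A} → Unique xs →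
                          ∀ {i j} → lookup xs i ≡ lookup xs j → i ≡ j
Unique⇒lookup-injective (_ ∷ _)  {zero}  {zero}  _  = refl
Unique⇒lookup-injective (x∉ ∷ _) {zero}  {suc j} eq = contradiction eq (All.lookup x∉ (∈-lookup j))
Unique⇒lookup-injective (x∉ ∷ _) {suc i} {zero}  eq = contradiction (sym eq) (All.lookup x∉ (∈-lookup i))
Unique⇒lookup-injective (_ ∷ u)  {suc i} {suc j} eq = cong suc (Unique⇒lookup-injective u eq)

Unique⇒length≤ : ∀ {c} {xs : List (Fin c)} → Unique xs → length xs ≤ c
Unique⇒length≤ u = injective⇒≤ (Unique⇒lookup-injective u)

length-arcColours : ∀ {n c} {D : Digraph n} {x y} (f : Fin n → Fin n → Fin c) (w : Walk D x y) →
                    length (arcColours f w) ≡ len w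
length-arcColours f []      = refl
length-arcColours f (_ ∷ w) = cong suc (length-arcColours f w)

-- Phases and colours on the grid.

module Colouring (m a′ : ℕ) (N≤a : 2 + m ≤ suc a′) where

  B N k a n : ℕ
  B = 1 + m
  N = 2 + m
  k = 3 + m
  a = suc a′
  n = a * k

  1<a : 1 < a
  1<a = ≤-trans (s≤s (s≤s z≤n)) N≤a

  -- The phase of the unit arc leaving (i , j) is its place in its block: below B for a base
  -- colour, B for the row colour, and N for a surplus arc, which only occurs in rows i ≥ N.
  phase : ℕ → ℕ → ℕ
  phase i j with i <? N
  ... | yes _ = (i + j) % N
  ... | no  _ = j

  -- Base colours are numbered from `a` on, so that `a ≤ c` is the test that `c` is not a row
  -- colour. The surplus colour wraps, because row `a - 1` is followed by row 0.
  decode : ℕ → ℕ → ℕ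
  decode i s with <-cmp s B
  ... | tri< _ _ _ = a + s
  ... | tri≈ _ _ _ = i
  ... | tri> _ _ _ = suc i % a

  gridColour : ℕ → ℕ → ℕ
  gridColour i j = decode i (phase i j)

  phase-low : ∀ {i} j → i < N → phase i j ≡ (i + j) % N
  phase-low {i} j i<N with i <? N
  ... | yes _  = refl
  ... | no i≮N = contradiction i<N i≮N

  phase-high : ∀ {i} j → N ≤ i → phase i j ≡ j
  phase-high {i} j N≤i with i <? N
  ... | yes i<N = contradiction N≤i (<⇒≱ i<N)
  ... | no _    = refl

  phase-<N : ∀ i {j} → j < N → phase i j < N
  phase-<N i {j} j<N with i <? N
  ... | yes _ = m%n<n (i + j) N
  ... | no  _ = j<N

  phase-≤N : ∀ i {j} → j < k → phase i j ≤ N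
  phase-≤N i {j} j<k with i <? N
  ... | yes _ = <⇒≤ (m%n<n (i + j) N)
  ... | no  _ = s≤s⁻¹ j<k

  -- The row after `i` starts a fresh block: either it is a high row, or it is row 0, where the
  -- phase is `j % N`.
  phase-after-seam : ∀ {i j} → B ≤ i → i < a → j < N → phase (suc i % a) j ≡ j
  phase-after-seam {i} {j} B≤i i<a j<N with m≤n⇒m<n∨m≡n i<a
  ... | inj₁ si<a = trans (cong (λ z → phase z j) (m<n⇒m%n≡m si<a)) (phase-high j (s≤s B≤i))
  ... | inj₂ si≡a = trans (cong (λ z → phase z j) (trans (cong (_% a) si≡a) (n%n≡0 a)))
                          (trans (phase-low j z<s) (m<n⇒m%n≡m j<N))

  decode-base : ∀ i {s} → s < B → decode i s ≡ a + s
  decode-base i {s} s<B with <-cmp s B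
  ... | tri< _ _ _   = refl
  ... | tri≈ s≮B _ _ = contradiction s<B s≮B
  ... | tri> s≮B _ _ = contradiction s<B s≮B

  decode-B : ∀ i → decode i B ≡ i
  decode-B i with <-cmp B B
  ... | tri< _ B≢B _ = contradiction refl B≢B
  ... | tri≈ _ _ _   = refl
  ... | tri> _ B≢B _ = contradiction refl B≢B

  decode-<N : ∀ i {s} → s < N → a ≤ decode i s ⊎ decode i s ≡ i
  decode-<N i {s} s<N with <-cmp s B
  ... | tri< _ _ _   = inj₁ (m≤m+n a s)
  ... | tri≈ _ _ _   = inj₂ refl
  ... | tri> _ _ B<s = contradiction s<N (≤⇒≯ B<s)

  decode-any : ∀ i s → a ≤ decode i s ⊎ decode i s ≡ i ⊎ decode i s ≡ suc i % a
  decode-any i s with <-cmp s B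
  ... | tri< _ _ _ = inj₁ (m≤m+n a s)
  ... | tri≈ _ _ _ = inj₂ (inj₁ refl)
  ... | tri> _ _ _ = inj₂ (inj₂ refl)

  decode-bound : ∀ {i} s → i < a → decode i s < a + B
  decode-bound {i} s i<a with <-cmp s B
  ... | tri< s<B _ _ = +-monoʳ-< a s<B
  ... | tri≈ _ _ _   = <-≤-trans i<a (m≤m+n a B)
  ... | tri> _ _ _   = <-≤-trans (m%n<n (suc i) a) (m≤m+n a B)

  -- Phases `B` and `N` are the only two different ones that can share a colour, the first giving
  -- its own row and the second the row after. The last two hypotheses exclude this clash.
  decode-≢ : ∀ {i i′ s s′} → i < a → i′ < a → s ≤ N → s′ ≤ N → s ≢ s′ →
             (s ≡ B → s′ ≡ N → i ≢ suc i′ % a) →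
             (s ≡ N → s′ ≡ B → suc i % a ≢ i′) →
             decode i s ≢ decode i′ s′
  decode-≢ {i} {i′} {s} {s′} i<a i′<a s≤N s′≤N s≢s′ BN NB with <-cmp s B | <-cmp s′ B
  ... | tri< _ _ _ | tri< _ _ _ = λ eq → s≢s′ (+-cancelˡ-≡ a _ _ eq)
  ... | tri< _ _ _ | tri≈ _ _ _ = >⇒≢ (<-≤-trans i′<a (m≤m+n a s))
  ... | tri< _ _ _ | tri> _ _ _ = >⇒≢ (<-≤-trans (m%n<n (suc i′) a) (m≤m+n a s))
  ... | tri≈ _ _ _ | tri< _ _ _ = <⇒≢ (<-≤-trans i<a (m≤m+n a s′))
  ... | tri> _ _ _ | tri< _ _ _ = <⇒≢ (<-≤-trans (m%n<n (suc i) a) (m≤m+n a s′))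
  ... | tri≈ _ s≡B _ | tri≈ _ s′≡B _ = contradiction (trans s≡B (sym s′≡B)) s≢s′
  ... | tri≈ _ s≡B _ | tri> _ _ B<s′ = BN s≡B (≤-antisym s′≤N B<s′)
  ... | tri> _ _ B<s | tri≈ _ s′≡B _ = NB (≤-antisym s≤N B<s) s′≡B
  ... | tri> _ _ B<s | tri> _ _ B<s′ =
    contradiction (trans (≤-antisym s≤N B<s) (sym (≤-antisym s′≤N B<s′))) s≢s′

  i≢suc-i : ∀ {i} → i < a → i ≢ suc i % a
  i≢suc-i {i} i<a eq =
    %-≢ a (n<1+n i) (subst (suc i <_) (+-comm a i) (+-monoˡ-< i 1<a)) (trans (m<n⇒m%n≡m i<a) eq)

  -- Unit arcs less than `N = k - 1` apart.

  -- Low rows count residues modulo `N` and high rows count columns, so the phases differ. A clash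
  -- of row colours would identify row `i` with its successor modulo `a`.
  gridColour-row : ∀ {i j δ} → i < a → 0 < δ → δ < N → j + δ < k →
                   gridColour i j ≢ gridColour i (j + δ)
  gridColour-row {i} {j} {δ} i<a 0<δ δ<N j+δ<k =
    decode-≢ i<a i<a (phase-≤N i (≤-<-trans (m≤m+n j δ) j+δ<k)) (phase-≤N i j+δ<k)
      phases (λ _ _ → i≢suc-i i<a) (λ _ _ eq → i≢suc-i i<a (sym eq))
    where
    phases : phase i j ≢ phase i (j + δ)
    phases with i <? N
    ... | yes _ = %-≢ N (+-monoʳ-< i (m<m+n j 0<δ))
                        (subst (_< i + j + N) (+-assoc i j δ) (+-monoʳ-< (i + j) δ<N))
    ... | no  _ = <⇒≢ (m<m+n j 0<δ)

  gridColour-nextRow : ∀ {i j δ j′} → i < a → j < k → 0 < δ → δ < N → j + δ ≡ k + j′ →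
                       gridColour i j ≢ gridColour (suc i % a) j′
  gridColour-nextRow {i} {j} {δ} {j′} i<a j<k 0<δ δ<N eq =
    decode-≢ i<a (m%n<n (suc i) a) (phase-≤N i j<k) (<⇒≤ (phase-<N (suc i % a) j′<N)) phases
      (λ _ s′≡N → contradiction s′≡N (<⇒≢ (phase-<N (suc i % a) j′<N)))
      (λ s≡N s′≡B → ⊥-elim (extra s≡N s′≡B))
    where
    2+j′≤j : 2 + j′ ≤ j
    -- Since `δ ≤ B = k - 2`, the second arc lies at least two columns to the left of the first. In
    -- particular it is not in the last column, so it is no surplus arc.
    2+j′≤j = +-cancelʳ-≤ B (2 + j′) j (begin
      2 + j′ + B    ≡⟨ shuffle j′ m ⟩
      k + j′        ≡⟨ eq ⟨
      j + δ         ≤⟨ +-monoʳ-≤ j (s≤s⁻¹ δ<N) ⟩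
      j + B         ∎)
      where
      open ≤-Reasoning
      shuffle : ∀ j′ m → 2 + j′ + (1 + m) ≡ (3 + m) + j′
      shuffle = solve-∀

    j′<B : j′ < B
    j′<B = s≤s⁻¹ (≤-trans 2+j′≤j (s≤s⁻¹ j<k))

    j′<N : j′ < N
    j′<N = m<n⇒m<1+n j′<B

    extra : phase i j ≡ N → phase (suc i % a) j′ ≡ B → ⊥
    extra p≡N p′≡B with i <? N
    ... | yes _  = <⇒≢ (m%n<n (i + j) N) p≡N
    ... | no i≮N = <⇒≢ j′<B (trans (sym (phase-after-seam (≤-trans (n≤1+n B) (≮⇒≥ i≮N)) i<a j′<N)) p′≡B)

    phases : phase i j ≢ phase (suc i % a) j′
    phases with <-cmp i B
    -- Both rows are low. Because `k = N + 1`, the value `i + j` continues modulo `N` across the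
    -- boundary, so the phases still differ by `δ` modulo `N`.
    ... | tri< i<B _ _ = λ e → %-≢ N below above (begin
          (i + j) % N               ≡⟨ phase-low j (m<n⇒m<1+n i<B) ⟨
          phase i j                 ≡⟨ e ⟩
          phase (suc i % a) j′      ≡⟨ cong (λ z → phase z j′) (m<n⇒m%n≡m (<-≤-trans (s≤s i<B) N≤a)) ⟩
          phase (suc i) j′          ≡⟨ phase-low j′ (s≤s i<B) ⟩
          (suc i + j′) % N          ≡⟨ [m+n]%n≡m%n (suc i + j′) N ⟨
          (suc i + j′ + N) % N      ≡⟨ cong (_% N) sum≡ ⟩
          (i + j + δ) % N           ∎)
      where
      open ≡-Reasoning
      shuffle : ∀ i j′ m → suc i + j′ + (2 + m) ≡ i + ((3 + m) + j′)
      shuffle = solve-∀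
      sum≡ : suc i + j′ + N ≡ i + j + δ
      sum≡ = trans (shuffle i j′ m) (trans (cong (i +_) (sym eq)) (sym (+-assoc i j δ)))
      below : i + j < i + j + δ
      below = m<m+n (i + j) 0<δ
      above : i + j + δ < i + j + N
      above = +-monoʳ-< (i + j) δ<N
    -- Row `B` is the last low row: `(B + j) % N` is `j - 1`, while the next row starts afresh with
    -- phase `j′ ≤ j - 2`.
    ... | tri≈ _ refl _ with split-≤ 2+j′≤j
    ...   | z , refl = λ e → >⇒≢ (s≤s (m≤m+n j′ z))
                               (trans (sym B-phase) (trans e (phase-after-seam ≤-refl i<a j′<N)))
      where
      shuffle : ∀ z j′ m → (1 + m) + (2 + j′ + z) ≡ suc (j′ + z) + (2 + m)
      shuffle = solve-∀
      B-phase : phase B (2 + j′ + z) ≡ suc (j′ + z)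
      B-phase = begin
        phase B (2 + j′ + z)           ≡⟨ phase-low (2 + j′ + z) (n<1+n B) ⟩
        (B + (2 + j′ + z)) % N         ≡⟨ cong (_% N) (shuffle z j′ m) ⟩
        (suc (j′ + z) + N) % N         ≡⟨ [m+n]%n≡m%n (suc (j′ + z)) N ⟩
        suc (j′ + z) % N               ≡⟨ m<n⇒m%n≡m (s≤s⁻¹ j<k) ⟩
        suc (j′ + z)                   ∎
        where open ≡-Reasoning
    phases | tri> _ _ B<i = λ e → >⇒≢ (≤-trans (n≤1+n (suc j′)) 2+j′≤j)
      (trans (sym (phase-high j B<i)) (trans e (phase-after-seam (<⇒≤ B<i) i<a j′<N)))

  -- Positions P are lifted to ℕ, the universal cover of the cycle: rows are taken modulo a.
  unitColour jumpColour : ℕ → ℕ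
  unitColour P = gridColour (P / k % a) (P % k)
  jumpColour P = P / k % a

  jumpColour-row : ∀ s {j} → j < k → jumpColour (s * k + j) ≡ s % a
  jumpColour-row s j<k = cong (_% a) ([i*k+j]/k≡i s k j<k)

  unitColour-row : ∀ s {j} → j < k → unitColour (s * k + j) ≡ gridColour (s % a) j
  unitColour-row s j<k = cong₂ gridColour (jumpColour-row s j<k) ([i*k+j]%k≡j s k j<k)

  next-row : ∀ s j → s * k + (k + j) ≡ suc s * k + j
  next-row s j = trans (sym (+-assoc (s * k) k j)) (cong (_+ j) (+-comm (s * k) k))

  unitColour-nextRow : ∀ s {j} → j < k → unitColour (s * k + (k + j)) ≡ gridColour (suc s % a) j
  unitColour-nextRow s {j} j<k = trans (cong unitColour (next-row s j)) (unitColour-row (suc s) j<k)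

  -- A distance below `N` crosses at most one row boundary, so the same-row and next-row cases
  -- suffice.
  unitColour-≢ : ∀ P {δ} → 0 < δ → δ < N → unitColour P ≢ unitColour (P + δ)
  unitColour-≢ P {δ} 0<δ δ<N with P % k + δ <? k
  ... | yes j+δ<k = λ eq → gridColour-row (m%n<n (P / k) a) 0<δ δ<N j+δ<k
                      (trans eq (trans (cong unitColour shift) (unitColour-row (P / k) j+δ<k)))
    where
    shift : P + δ ≡ P / k * k + (P % k + δ)
    shift = trans (cong (_+ δ) (trans (m≡m%n+[m/n]*n P k) (+-comm (P % k) _))) (+-assoc (P / k * k) _ δ)
  ... | no j+δ≮k with split-≤ (≮⇒≥ j+δ≮k)
  ...   | j′ , eq′ = λ eq → gridColour-nextRow (m%n<n (P / k) a) (m%n<n P k) 0<δ δ<N eq′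
                       (trans eq (trans (cong unitColour shift) (trans (unitColour-nextRow (P / k) j′<k)
                         (cong (λ z → gridColour z j′) (sym (suc-%-% (P / k) a))))))
    where
    shift : P + δ ≡ P / k * k + (k + j′)
    shift = trans (cong (_+ δ) (trans (m≡m%n+[m/n]*n P k) (+-comm (P % k) _)))
                  (trans (+-assoc (P / k * k) _ δ) (cong (P / k * k +_) eq′))
    j′<k : j′ < k
    j′<k = +-cancelˡ-< k j′ k (subst (_< k + k) eq′ (+-mono-< (m%n<n P k) (m<n⇒m<1+n δ<N)))

  -- Row colours met along runs of unit arcs.

  -- A surplus arc can only sit in the last column `N`.
  window-row : ∀ s {x} → x < N → let c = unitColour (s * k + x) in a ≤ c ⊎ c ≡ s % a
  window-row s {x} x<N rewrite unitColour-row s (m<n⇒m<1+n x<N) =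
    decode-<N (s % a) (phase-<N (s % a) x<N)

  -- Row `s` itself contributes at most its own colour and, by a surplus arc, that of the next row.
  -- The part of the next row that is reached stops before its last column.
  window-any : ∀ s {x} → x < k + N → let c = unitColour (s * k + x) in
               a ≤ c ⊎ c ≡ s % a ⊎ c ≡ suc s % a
  window-any s {x} x<k+N with x <? k
  ... | yes x<k rewrite unitColour-row s x<k | sym (suc-%-% s a) = decode-any (s % a) (phase (s % a) x)
  ... | no x≮k with split-≤ (≮⇒≥ x≮k)
  ...   | j , refl with +-cancelˡ-< k j N x<k+N
  ...     | j<N rewrite unitColour-nextRow s (m<n⇒m<1+n j<N) =
    [ inj₁ , (λ c≡ → inj₂ (inj₂ c≡)) ]′ (decode-<N (suc s % a) (phase-<N (suc s % a) j<N))

  gridColour-base : ∀ i {j} → phase i j < B → a ≤ gridColour i j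
  gridColour-base i {j} p<B = subst (a ≤_) (sym (decode-base i p<B)) (m≤m+n a (phase i j))

  -- The last column of row 0 has phase `N % N = 0`, and row 1 continues with phases `1 + j`, which
  -- stay below `B` for `j < m`.
  window-row0 : ∀ s {x} → s % a ≡ 0 → x < k + m → let c = unitColour (s * k + x) in a ≤ c ⊎ c ≡ s % a
  window-row0 s {x} s≡0 x<k+m with x <? N | x <? k
  ... | yes x<N | _       = window-row s x<N
  ... | no x≮N  | yes x<k = inj₁ (subst (a ≤_) (sym (unitColour-row s x<k)) (gridColour-base (s % a) base))
    where
    base : phase (s % a) x < B
    base = subst₂ (λ i j → phase i j < B) (sym s≡0) (≤-antisym (≮⇒≥ x≮N) (s≤s⁻¹ x<k))
             (subst (_< B) (sym (trans (phase-low N z<s) (n%n≡0 N))) z<s)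
  ... | no _    | no x≮k with split-≤ (≮⇒≥ x≮k)
  ...   | j , refl = inj₁ (subst (a ≤_) (sym (unitColour-nextRow s j<k)) (gridColour-base (suc s % a) base))
    where
    j<m : j < m
    j<m = +-cancelˡ-< k j m x<k+m
    j<k : j < k
    j<k = <-≤-trans j<m (m≤n+m m 3)
    row≡1 : suc s % a ≡ 1
    row≡1 = trans (sym (suc-%-% s a)) (trans (cong (λ z → suc z % a) s≡0) (m<n⇒m%n≡m 1<a))
    base : phase (suc s % a) j < B
    base = subst (_< B) (sym (trans (cong (λ i → phase i j) row≡1)
             (trans (phase-low j (s≤s (s≤s z≤n))) (m<n⇒m%n≡m (s≤s (m<n⇒m<1+n j<m)))))) (s≤s j<m)

  -- The last column of row `B` has phase `(B + N) % N = B`, the row's own colour. The next row then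
  -- starts a fresh block with its base colours.
  window-rowB : ∀ s {x} → s % a ≡ B → N ≤ x → x < k + B → let c = unitColour (s * k + x) in a ≤ c ⊎ c ≡ s % a
  window-rowB s {x} s≡B N≤x x<k+B with x <? k
  ... | yes x<k = inj₂ (begin
        unitColour (s * k + x)            ≡⟨ unitColour-row s x<k ⟩
        decode (s % a) (phase (s % a) x)  ≡⟨ cong (decode (s % a)) p≡B ⟩
        decode (s % a) B                  ≡⟨ decode-B (s % a) ⟩
        s % a                             ∎)
    where
    open ≡-Reasoning
    p≡B : phase (s % a) x ≡ B
    p≡B = begin
      phase (s % a) x   ≡⟨ cong₂ phase s≡B (≤-antisym (s≤s⁻¹ x<k) N≤x) ⟩
      phase B N         ≡⟨ phase-low N (n<1+n B) ⟩
      (B + N) % N       ≡⟨ [m+n]%n≡m%n B N ⟩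
      B % N             ≡⟨ m<n⇒m%n≡m (n<1+n B) ⟩
      B                 ∎
  ... | no x≮k with split-≤ (≮⇒≥ x≮k)
  ...   | j , refl = inj₁ (subst (a ≤_) (sym (unitColour-nextRow s (m<n⇒m<1+n j<N))) (gridColour-base (suc s % a) base))
    where
    j<B : j < B
    j<B = +-cancelˡ-< k j B x<k+B
    j<N : j < N
    j<N = m<n⇒m<1+n j<B
    base : phase (suc s % a) j < B
    base = subst (_< B) (sym (trans (cong (λ i → phase i j) (sym (suc-%-% s a)))
             (phase-after-seam (≤-reflexive (sym s≡B)) (m%n<n s a) j<N))) j<B

  -- Step sequences on the cover and their colours.

  data Step : Set where
    unit jump : Step

  size : Step → ℕ
  size unit = 1
  size jump = k

  stepColour : Step → ℕ → ℕ
  stepColour unit = unitColour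
  stepColour jump = jumpColour

  end : ℕ → List Step → ℕ
  end P []       = P
  end P (s ∷ ss) = end (P + size s) ss

  colours : ℕ → List Step → List ℕ
  colours P []       = []
  colours P (s ∷ ss) = stepColour s P ∷ colours (P + size s) ss

  colours-++ : ∀ P ss ts → colours P (ss ++ ts) ≡ colours P ss ++ colours (end P ss) ts
  colours-++ P []       ts = refl
  colours-++ P (s ∷ ss) ts = cong (stepColour s P ∷_) (colours-++ (P + size s) ss ts)

  end-++ : ∀ P ss ts → end P (ss ++ ts) ≡ end (end P ss) ts
  end-++ P []       ts = refl
  end-++ P (s ∷ ss) ts = end-++ (P + size s) ss ts

  end-replicate : ∀ P r s → end P (replicate r s) ≡ P + r * size s
  end-replicate P zero    s = sym (+-identityʳ P)
  end-replicate P (suc r) s = trans (end-replicate (P + size s) r s) (+-assoc P (size s) (r * size s))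

  colours-replicate : ∀ P r s → colours P (replicate r s) ≡ applyUpTo (λ t → stepColour s (P + t * size s)) r
  colours-replicate P r s = go P r (λ _ → refl)
    where
    go : ∀ {f} Q r → (∀ t → stepColour s (Q + t * size s) ≡ f t) → colours Q (replicate r s) ≡ applyUpTo f r
    go Q zero    _  = refl
    go Q (suc r) eq = cong₂ _∷_
      (trans (cong (stepColour s) (sym (+-identityʳ Q))) (eq 0))
      (go (Q + size s) r (λ t → trans (cong (stepColour s) (+-assoc Q (size s) (t * size s))) (eq (suc t))))

  -- With the units in the middle, the row in which they are taken can be varied while the total of
  -- jumps stays `p + p′`.
  route : ℕ → ℕ → ℕ → List Step
  route p r p′ = replicate p jump ++ replicate r unit ++ replicate p′ jump

  %-offset-≢ : ∀ i {u v} → u < v → v < a → (i + u) % a ≢ (i + v) % a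
  %-offset-≢ i {u} {v} u<v v<a = %-≢ a (+-monoʳ-< i u<v) (begin-strict
    i + v        <⟨ +-monoʳ-< i v<a ⟩
    i + a        ≤⟨ +-monoˡ-≤ a (m≤m+n i u) ⟩
    i + u + a    ∎)
    where open ≤-Reasoning

  -- Colours of jumps are (i + t) % a with t < p or p < t ≤ p + p′; the last hypothesis says
  -- that the row colours on the unit arcs avoid these.
  route-rainbow : ∀ i {d} p r p′ → d < k → r < k → p + p′ < a → p′ ≡ 0 ⊎ k ≤ d + r →
    (∀ {t} → t < r → let c = unitColour ((i + p) * k + (d + t)) in
       a ≤ c ⊎ ∃ λ u → (u ≡ p ⊎ p + p′ < u) × u < a × c ≡ (i + u) % a) →
    Unique (colours (i * k + d) (route p r p′))
  route-rainbow i {d} p r p′ d<k r<k p+p′<a wraps window =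
    subst Unique (sym colours≡)
      (++⁺ uniqueU (++⁺ uniqueV uniqueW disjointVW) disjointU)
    where
    P = i * k + d

    fU fV fW : ℕ → ℕ
    fU t = (i + t) % a
    fV t = unitColour ((i + p) * k + (d + t))
    -- The `suc` accounts for the row boundary crossed by the units, which `k ≤ d + r` guarantees
    -- whenever later jumps exist.
    fW t = (i + (p + suc t)) % a

    U V W : List ℕ
    U = applyUpTo fU p
    V = applyUpTo fV r
    W = applyUpTo fW p′

    cong-upTo : ∀ {f g : ℕ → ℕ} r → (∀ t → t < r → f t ≡ g t) → applyUpTo f r ≡ applyUpTo g r
    cong-upTo zero    _  = refl
    cong-upTo (suc r) eq = cong₂ _∷_ (eq 0 z<s) (cong-upTo r (λ t t<r → eq (suc t) (s≤s t<r)))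

    move : ∀ i d t k → i * k + d + t * k ≡ (i + t) * k + d
    move = solve-∀

    move₁ : ∀ i p d t k → i * k + d + p * k + t * 1 ≡ (i + p) * k + (d + t)
    move₁ = solve-∀

    U≡ : colours P (replicate p jump) ≡ U
    U≡ = trans (colours-replicate P p jump) (cong-upTo p λ t _ →
      trans (cong jumpColour (move i d t k)) (jumpColour-row (i + t) d<k))

    V≡ : colours (P + p * k) (replicate r unit) ≡ V
    V≡ = trans (colours-replicate (P + p * k) r unit) (cong-upTo r λ t _ →
      cong unitColour (move₁ i p d t k))

    W≡ : colours (P + p * k + r * 1) (replicate p′ jump) ≡ W
    W≡ = trans (colours-replicate (P + p * k + r * 1) p′ jump) (cong-upTo p′ (same wraps))
      where
      same : p′ ≡ 0 ⊎ k ≤ d + r → ∀ t → t < p′ → jumpColour (P + p * k + r * 1 + t * k) ≡ fW t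
      same (inj₁ p′≡0)   t t<p′ = contradiction (subst (t <_) p′≡0 t<p′) (λ ())
      same (inj₂ k≤d+r) t t<p′ with split-≤ k≤d+r
      ... | e , d+r≡k+e = trans (cong jumpColour pos) (jumpColour-row (i + (p + suc t)) e<k)
        where
        e<k : e < k
        e<k = +-cancelˡ-< k e k (subst (_< k + k) d+r≡k+e (+-mono-< d<k r<k))
        gather : ∀ i d p r t k → i * k + d + p * k + r * 1 + t * k ≡ (i + p + t) * k + (d + r)
        gather = solve-∀
        spread : ∀ i p t k e → (i + p + t) * k + (k + e) ≡ (i + (p + suc t)) * k + e
        spread = solve-∀
        pos : P + p * k + r * 1 + t * k ≡ (i + (p + suc t)) * k + e
        pos = trans (gather i d p r t k) (trans (cong ((i + p + t) * k +_) d+r≡k+e) (spread i p t k e))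

    colours≡ : colours P (route p r p′) ≡ U ++ V ++ W
    colours≡ = begin
      colours P (route p r p′)
        ≡⟨ colours-++ P (replicate p jump) _ ⟩
      colours P (replicate p jump) ++ colours (end P (replicate p jump)) (replicate r unit ++ replicate p′ jump)
        ≡⟨ cong₂ (λ us Q → us ++ colours Q (replicate r unit ++ replicate p′ jump)) U≡ (end-replicate P p jump) ⟩
      U ++ colours (P + p * k) (replicate r unit ++ replicate p′ jump)
        ≡⟨ cong (U ++_) (colours-++ (P + p * k) (replicate r unit) _) ⟩
      U ++ colours (P + p * k) (replicate r unit) ++ colours (end (P + p * k) (replicate r unit)) (replicate p′ jump)
        ≡⟨ cong₂ (λ vs Q → U ++ vs ++ colours Q (replicate p′ jump)) V≡ (end-replicate (P + p * k) r unit) ⟩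
      U ++ V ++ colours (P + p * k + r * 1) (replicate p′ jump)
        ≡⟨ cong (λ ws → U ++ V ++ ws) W≡ ⟩
      U ++ V ++ W ∎
      where open ≡-Reasoning

    p<a : p < a
    p<a = ≤-<-trans (m≤m+n p p′) p+p′<a

    tail<a : ∀ {t} → t < p′ → p + suc t < a
    tail<a t<p′ = ≤-<-trans (+-monoʳ-≤ p t<p′) p+p′<a

    uniqueU : Unique U
    uniqueU = applyUpTo⁺₁ fU p λ t<t′ t′<p → %-offset-≢ i t<t′ (<-trans t′<p p<a)

    uniqueW : Unique W
    uniqueW = applyUpTo⁺₁ fW p′ λ t<t′ t′<p′ → %-offset-≢ i (+-monoʳ-< p (s≤s t<t′)) (tail<a t′<p′)

    uniqueV : Unique V
    uniqueV = applyUpTo⁺₁ fV r distinct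
      where
      distinct : ∀ {t t′} → t < t′ → t′ < r → fV t ≢ fV t′
      distinct {t} t<t′ t′<r with split-≤ t<t′
      ... | δ , refl = λ eq → unitColour-≢ ((i + p) * k + (d + t)) z<s δ<N
                         (trans eq (cong unitColour (regroup ((i + p) * k) d t δ)))
        where
        regroup : ∀ x d t δ → x + (d + suc (t + δ)) ≡ x + (d + t) + suc δ
        regroup = solve-∀
        δ<N : suc δ < N
        δ<N = ≤-<-trans (s≤s (m≤n+m δ t)) (<-≤-trans t′<r (s≤s⁻¹ r<k))

    disjointVW : ∀ {c} → c ∈ V × c ∈ W → ⊥
    disjointVW (c∈V , c∈W) with ∈-applyUpTo⁻ fV c∈V | ∈-applyUpTo⁻ fW c∈W
    ... | t , t<r , refl | t′ , t′<p′ , eq with window t<r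
    ...   | inj₁ a≤c = <⇒≱ (m%n<n (i + (p + suc t′)) a) (subst (a ≤_) eq a≤c)
    ...   | inj₂ (u , inj₁ refl , _ , eq′) =
      %-offset-≢ i (m<m+n p z<s) (tail<a t′<p′) (trans (sym eq′) eq)
    ...   | inj₂ (u , inj₂ p+p′<u , u<a , eq′) =
      %-offset-≢ i (≤-<-trans (+-monoʳ-≤ p t′<p′) p+p′<u) u<a (trans (sym eq) eq′)

    disjointU : ∀ {c} → c ∈ U × c ∈ V ++ W → ⊥
    disjointU (c∈U , c∈VW) with ∈-applyUpTo⁻ fU c∈U | ∈-++⁻ V c∈VW
    ... | t , t<p , refl | inj₂ c∈W with ∈-applyUpTo⁻ fW c∈W
    ...   | t′ , t′<p′ , eq = %-offset-≢ i (<-≤-trans t<p (m≤m+n p (suc t′))) (tail<a t′<p′) eq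
    disjointU (c∈U , c∈VW) | t , t<p , refl | inj₁ c∈V with ∈-applyUpTo⁻ fV c∈V
    ... | t′ , t′<r , eq with window t′<r
    ...   | inj₁ a≤c = <⇒≱ (m%n<n (i + t) a) (subst (a ≤_) (sym eq) a≤c)
    ...   | inj₂ (u , inj₁ refl , u<a , eq′) = %-offset-≢ i t<p u<a (trans eq eq′)
    ...   | inj₂ (u , inj₂ p+p′<u , u<a , eq′) =
      %-offset-≢ i (<-trans (<-≤-trans t<p (m≤m+n p p′)) p+p′<u) u<a (trans eq eq′)

  -- The split of `q` is delicate only if the units cross a boundary and `q = a - 1`. Jumps then
  -- leave every row except that at offset `p`, so its colour is the only row colour the units may
  -- meet.
  rainbow-route : ∀ i {d} q r → d < k → q < a → r < k →
    ∃₂ λ p p′ → p + p′ ≡ q × Unique (colours (i * k + d) (route p r p′))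
  rainbow-route i {d} q r d<k q<a r<k with d + r <? k
  ... | yes d+r<k = q , 0 , +-identityʳ q ,
    route-rainbow i q r 0 d<k r<k (subst (_< a) (sym (+-identityʳ q)) q<a) (inj₁ refl) window
    where
    window : ∀ {t} → t < r → let c = unitColour ((i + q) * k + (d + t)) in
             a ≤ c ⊎ ∃ λ u → (u ≡ q ⊎ q + 0 < u) × u < a × c ≡ (i + u) % a
    window t<r with window-row (i + q) (<-≤-trans (+-monoʳ-< d t<r) (s≤s⁻¹ d+r<k))
    ... | inj₁ a≤c = inj₁ a≤c
    ... | inj₂ c≡  = inj₂ (q , inj₁ refl , q<a , c≡)
  ... | no d+r≮k with m≤n⇒m<n∨m≡n q<a
  ...   | inj₁ 1+q<a = q , 0 , +-identityʳ q ,
    route-rainbow i q r 0 d<k r<k (subst (_< a) (sym (+-identityʳ q)) q<a) (inj₁ refl) window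
    where
    window : ∀ {t} → t < r → let c = unitColour ((i + q) * k + (d + t)) in
             a ≤ c ⊎ ∃ λ u → (u ≡ q ⊎ q + 0 < u) × u < a × c ≡ (i + u) % a
    window t<r with window-any (i + q) (+-mono-< d<k (<-≤-trans t<r (s≤s⁻¹ r<k)))
    ... | inj₁ a≤c        = inj₁ a≤c
    ... | inj₂ (inj₁ c≡)  = inj₂ (q , inj₁ refl , q<a , c≡)
    -- Offset `q + 1` lies beyond all jumps and, as `q < a - 1`, below `a`, so the second row colour
    -- is still free.
    ... | inj₂ (inj₂ c≡)  = inj₂ (suc q , inj₂ (s≤s (≤-reflexive (+-identityʳ q))) , 1+q<a ,
                                  trans c≡ (cong (_% a) (sym (+-suc i q))))
  ...   | inj₂ 1+q≡a with d <? N
  -- For `d < N` the units are taken from row 0.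
  ...     | yes d<N with %-reach a i {0} z<s
  ...       | p , p<a , i+p≡0 with split-≤ (s≤s⁻¹ (subst (p <_) (sym 1+q≡a) p<a))
  ...         | p′ , refl = p , p′ , refl ,
    route-rainbow i p r p′ d<k r<k q<a (inj₂ (≮⇒≥ d+r≮k)) window
    where
    window : ∀ {t} → t < r → let c = unitColour ((i + p) * k + (d + t)) in
             a ≤ c ⊎ ∃ λ u → (u ≡ p ⊎ p + p′ < u) × u < a × c ≡ (i + u) % a
    window {t} t<r with window-row0 (i + p) {d + t} i+p≡0 (s≤s (begin
        -- Both `d` and `t` are at most `B`, which just fits the range of `window-row0`.
        d + t            ≤⟨ +-mono-≤ (s≤s⁻¹ d<N) (s≤s⁻¹ (<-≤-trans t<r (s≤s⁻¹ r<k))) ⟩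
        B + B            ≡⟨ +-suc B m ⟩
        N + m            ∎))
      where open ≤-Reasoning
    ... | inj₁ a≤c = inj₁ a≤c
    ... | inj₂ c≡  = inj₂ (p , inj₁ refl , p<a , c≡)
  -- Now `d = N`. Row 0 could fail, since the units may reach column `m` of row 1, which carries the
  -- colour of row 1. Row `B` exists because `N ≤ a`.
  rainbow-route i {d} q r d<k q<a r<k | no d+r≮k | inj₂ 1+q≡a | no d≮N with %-reach a i {B} N≤a
  ... | p , p<a , i+p≡B with split-≤ (s≤s⁻¹ (subst (p <_) (sym 1+q≡a) p<a))
  ...   | p′ , refl = p , p′ , refl ,
    route-rainbow i p r p′ d<k r<k q<a (inj₂ (≮⇒≥ d+r≮k)) window
    where
    window : ∀ {t} → t < r → let c = unitColour ((i + p) * k + (d + t)) in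
             a ≤ c ⊎ ∃ λ u → (u ≡ p ⊎ p + p′ < u) × u < a × c ≡ (i + u) % a
    window {t} t<r with window-rowB (i + p) {d + t} i+p≡B (≤-trans (≮⇒≥ d≮N) (m≤m+n d t)) (s≤s (begin
        d + t            ≤⟨ +-mono-≤ (s≤s⁻¹ d<k) (s≤s⁻¹ (<-≤-trans t<r (s≤s⁻¹ r<k))) ⟩
        N + B            ∎))
      where open ≤-Reasoning
    ... | inj₁ a≤c = inj₁ a≤c
    ... | inj₂ c≡  = inj₂ (p , inj₁ refl , p<a , c≡)

  end-route : ∀ P p r p′ → end P (route p r p′) ≡ P + ((p + p′) * k + r)
  end-route P p r p′ = begin
    end P (route p r p′)
      ≡⟨ end-++ P (replicate p jump) _ ⟩
    end (end P (replicate p jump)) (replicate r unit ++ replicate p′ jump)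
      ≡⟨ end-++ (end P (replicate p jump)) (replicate r unit) _ ⟩
    end (end (end P (replicate p jump)) (replicate r unit)) (replicate p′ jump)
      ≡⟨ cong (λ Q → end (end Q (replicate r unit)) (replicate p′ jump)) (end-replicate P p jump) ⟩
    end (end (P + p * k) (replicate r unit)) (replicate p′ jump)
      ≡⟨ cong (λ Q → end Q (replicate p′ jump)) (end-replicate (P + p * k) r unit) ⟩
    end (P + p * k + r * 1) (replicate p′ jump)
      ≡⟨ end-replicate (P + p * k + r * 1) p′ jump ⟩
    P + p * k + r * 1 + p′ * k
      ≡⟨ collect P p r p′ k ⟩
    P + ((p + p′) * k + r) ∎
    where
    open ≡-Reasoning
    collect : ∀ P p r p′ k → P + p * k + r * 1 + p′ * k ≡ P + ((p + p′) * k + r)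
    collect = solve-∀

  length-route : ∀ p r p′ → length (route p r p′) ≡ (p + p′) + r
  length-route p r p′ = begin
    length (route p r p′)  ≡⟨ length-++ (replicate p jump) ⟩
    length (replicate p jump) + length (replicate r unit ++ replicate p′ jump)
      ≡⟨ cong₂ _+_ (length-replicate p) (length-++ (replicate r unit)) ⟩
    p + (length (replicate r unit) + length (replicate p′ jump))
      ≡⟨ cong₂ (λ x y → p + (x + y)) (length-replicate r) (length-replicate p′) ⟩
    p + (r + p′)           ≡⟨ regroup p r p′ ⟩
    (p + p′) + r           ∎
    where
    open ≡-Reasoning
    regroup : ∀ p r p′ → p + (r + p′) ≡ (p + p′) + r
    regroup = solve-∀

  -- Descent from the cover to the circulant digraph.

  G : Digraph n
  G = Circulant n (1 ∷ k ∷ [])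

  vertex : ℕ → Fin n
  vertex P = fromℕ< (m%n<n P n)

  toℕ-vertex : ∀ P → toℕ (vertex P) ≡ P % n
  toℕ-vertex P = toℕ-fromℕ< (m%n<n P n)

  vertex≡ : ∀ P y {q} → P ≡ toℕ y + q * n → vertex P ≡ y
  vertex≡ P y {q} eq = toℕ-injective (begin
    toℕ (vertex P)          ≡⟨ toℕ-vertex P ⟩
    P % n                   ≡⟨ cong (_% n) eq ⟩
    (toℕ y + q * n) % n     ≡⟨ [m+kn]%n≡m%n (toℕ y) q n ⟩
    toℕ y % n               ≡⟨ m<n⇒m%n≡m (toℕ<n y) ⟩
    toℕ y                   ∎)
    where open ≡-Reasoning

  step-congruence : ∀ P x → ∃ λ q → toℕ (vertex P) + x ≡ toℕ (vertex (P + x)) + q * n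
  step-congruence P x = (P % n + x) / n , (begin
    toℕ (vertex P) + x                              ≡⟨ cong (_+ x) (toℕ-vertex P) ⟩
    P % n + x                                       ≡⟨ m≡m%n+[m/n]*n (P % n + x) n ⟩
    (P % n + x) % n + (P % n + x) / n * n           ≡⟨ cong (_+ (P % n + x) / n * n) (%-+-% P x n) ⟩
    (P + x) % n + (P % n + x) / n * n               ≡⟨ cong (_+ (P % n + x) / n * n) (toℕ-vertex (P + x)) ⟨
    toℕ (vertex (P + x)) + (P % n + x) / n * n      ∎)
    where open ≡-Reasoning

  arc : ∀ P s → G (vertex P) (vertex (P + size s))
  arc P unit = here (step-congruence P 1)
  arc P jump = there (here (step-congruence P k))

  walk : ∀ P ss → Walk G (vertex P) (vertex (end P ss))
  walk P []       = []
  walk P (s ∷ ss) = arc P s ∷ walk (P + size s) ss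

  len-walk : ∀ P ss → len (walk P ss) ≡ length ss
  len-walk P []       = refl
  len-walk P (s ∷ ss) = cong suc (len-walk (P + size s) ss)

  size>0 : ∀ s → 0 < size s
  size>0 unit = z<s
  size>0 jump = z<s

  end-≥ : ∀ P ss → P ≤ end P ss
  end-≥ P []       = ≤-refl
  end-≥ P (s ∷ ss) = ≤-trans (m≤m+n P (size s)) (end-≥ (P + size s) ss)

  vertices-walk : ∀ P ss → All (λ v → ∃ λ Q → v ≡ vertex Q × P ≤ Q × Q ≤ end P ss) (vertices (walk P ss))
  vertices-walk P []       = (P , refl , ≤-refl , ≤-refl) ∷ []
  vertices-walk P (s ∷ ss) = (P , refl , ≤-refl , end-≥ P (s ∷ ss)) ∷
    All.map (λ (Q , v≡ , P+s≤Q , Q≤end) → Q , v≡ , ≤-trans (m≤m+n P (size s)) P+s≤Q , Q≤end)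
            (vertices-walk (P + size s) ss)

  -- The lifted positions strictly increase and span less than `n`, so no two of them agree modulo
  -- `n`.
  walk-isPath : ∀ P ss → end P ss < P + n → IsPath (walk P ss)
  walk-isPath P []       _     = [] ∷ []
  walk-isPath P (s ∷ ss) end<  =
    All.map fresh (vertices-walk (P + size s) ss) ∷
    walk-isPath (P + size s) ss (<-≤-trans end< (+-monoˡ-≤ n (m≤m+n P (size s))))
    where
    fresh : ∀ {v} → (∃ λ Q → v ≡ vertex Q × P + size s ≤ Q × Q ≤ end P (s ∷ ss)) → vertex P ≢ v
    fresh (Q , refl , P+s≤Q , Q≤end) eq =
      %-≢ n (<-≤-trans (m<m+n P (size>0 s)) P+s≤Q) (≤-<-trans Q≤end end<)
          (trans (sym (toℕ-vertex P)) (trans (cong toℕ eq) (toℕ-vertex Q)))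

  -- The arc-colouring.

  -- A colouring sees only the endpoints, so whether an arc is a unit or a jump is read off from
  -- them. Pairs that are not unit arcs default to the jump colour.
  colour : Fin n → Fin n → ℕ
  colour x y with toℕ y ≟ (toℕ x + 1) % n
  ... | yes _ = unitColour (toℕ x)
  ... | no  _ = jumpColour (toℕ x)

  unitColour-bound : ∀ P → unitColour P < a + B
  unitColour-bound P = decode-bound (phase (P / k % a) (P % k)) (m%n<n (P / k) a)

  jumpColour-bound : ∀ P → jumpColour P < a + B
  jumpColour-bound P = <-≤-trans (m%n<n (P / k) a) (m≤m+n a B)

  colour-bound : ∀ x y → colour x y < a + B
  colour-bound x y with toℕ y ≟ (toℕ x + 1) % n
  ... | yes _ = unitColour-bound (toℕ x)
  ... | no  _ = jumpColour-bound (toℕ x)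

  -- As `n = a * k`, reducing modulo `n` changes the row by a multiple of `a` and keeps the column,
  -- so the lifted colours descend to the cycle.
  jumpColour-periodic : ∀ P → jumpColour (P % n) ≡ jumpColour P
  jumpColour-periodic P = trans (cong (_% a) (m%[n*o]/o≡m/o%n P a k)) (m%n%n≡m%n (P / k) a)

  unitColour-periodic : ∀ P → unitColour (P % n) ≡ unitColour P
  unitColour-periodic P = cong₂ gridColour (jumpColour-periodic P) (m∣n⇒o%n%m≡o%m k n P (n∣m*n a))

  colour-step : ∀ P s → colour (vertex P) (vertex (P + size s)) ≡ stepColour s P
  colour-step P s with toℕ (vertex (P + size s)) ≟ (toℕ (vertex P) + 1) % n
  colour-step P unit | yes _   = trans (cong unitColour (toℕ-vertex P)) (unitColour-periodic P)
  colour-step P unit | no ≢    = contradiction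
    (trans (toℕ-vertex (P + 1)) (trans (sym (%-+-% P 1 n)) (cong (λ z → (z + 1) % n) (sym (toℕ-vertex P))))) ≢
  colour-step P jump | no _    = trans (cong jumpColour (toℕ-vertex P)) (jumpColour-periodic P)
  -- A jump is never mistaken for a unit arc: `1 < k < 1 + n`.
  colour-step P jump | yes eq  = contradiction P+1≡P+k
    (%-≢ n (+-monoʳ-< P (s≤s z<s)) (subst (P + k <_) (sym (+-assoc P 1 n))
      (+-monoʳ-< P (s≤s (m≤m+n k (a′ * k))))))
    where
    P+1≡P+k : (P + 1) % n ≡ (P + k) % n
    P+1≡P+k = begin
      (P + 1) % n                   ≡⟨ %-+-% P 1 n ⟨
      (P % n + 1) % n               ≡⟨ cong (λ z → (z + 1) % n) (toℕ-vertex P) ⟨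
      (toℕ (vertex P) + 1) % n      ≡⟨ eq ⟨
      toℕ (vertex (P + k))          ≡⟨ toℕ-vertex (P + k) ⟩
      (P + k) % n                   ∎
      where open ≡-Reasoning

  colouring : Fin n → Fin n → Fin (a + B)
  colouring x y = fromℕ< (colour-bound x y)

  arcColours-walk : ∀ P ss → map toℕ (arcColours colouring (walk P ss)) ≡ colours P ss
  arcColours-walk P []       = refl
  arcColours-walk P (s ∷ ss) = cong₂ _∷_
    (trans (toℕ-fromℕ< (colour-bound (vertex P) (vertex (P + size s)))) (colour-step P s))
    (arcColours-walk (P + size s) ss)

  -- Displacements and distances.

  -- The second alternative is the case in which the cycle is closed on the way from x to y.
  Displacement : Fin n → Fin n → ℕ → Set
  Displacement x y d = d < n × (toℕ x + d ≡ toℕ y ⊎ toℕ x + d ≡ toℕ y + n)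

  displacement : ∀ x y → ∃ (Displacement x y)
  displacement x y with <-≤-connex (toℕ y) (toℕ x)
  ... | inj₂ x≤y with split-≤ x≤y
  ...   | d , y≡x+d = d , ≤-<-trans (subst (d ≤_) (sym y≡x+d) (m≤n+m d (toℕ x))) (toℕ<n y) , inj₁ (sym y≡x+d)
  displacement x y | inj₁ y<x with split-≤ (≤-trans (<⇒≤ (toℕ<n x)) (m≤n+m n (toℕ y)))
  ...   | d , y+n≡x+d = d , +-cancelˡ-< (toℕ x) d n (subst (_< toℕ x + n) y+n≡x+d (+-monoˡ-< n y<x)) , inj₂ (sym y+n≡x+d)

  -- The order of the arcs is forgotten: only the numbers `X` of jumps and `Y` of units enter the
  -- displacement and the length.
  walk-steps : ∀ {x y} (w : Walk G x y) →
               ∃ λ X → ∃₂ λ Y q → toℕ x + (X * k + Y) ≡ toℕ y + q * n × X + Y ≡ len w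
  walk-steps [] = 0 , 0 , 0 , refl , refl
  walk-steps {x} {y} (_∷_ {y = z} x→z w) with walk-steps w
  ... | X , Y , q′ , eq′ , X+Y≡len = first x→z
    where
    prepend : ∀ s q → toℕ x + s ≡ toℕ z + q * n →
              toℕ x + (s + (X * k + Y)) ≡ toℕ y + (q + q′) * n
    prepend s q eq = begin
      toℕ x + (s + (X * k + Y))        ≡⟨ +-assoc (toℕ x) s _ ⟨
      (toℕ x + s) + (X * k + Y)        ≡⟨ cong (_+ (X * k + Y)) eq ⟩
      (toℕ z + q * n) + (X * k + Y)    ≡⟨ swap (toℕ z) (q * n) (X * k + Y) ⟩
      (toℕ z + (X * k + Y)) + q * n    ≡⟨ cong (_+ q * n) eq′ ⟩
      (toℕ y + q′ * n) + q * n         ≡⟨ gather (toℕ y) q q′ n ⟩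
      toℕ y + (q + q′) * n             ∎
      where
      open ≡-Reasoning
      swap : ∀ u v w → (u + v) + w ≡ (u + w) + v
      swap = solve-∀
      gather : ∀ y q q′ n → (y + q′ * n) + q * n ≡ y + (q + q′) * n
      gather = solve-∀

    first : G x z → ∃ λ X → ∃₂ λ Y q → toℕ x + (X * k + Y) ≡ toℕ y + q * n × X + Y ≡ suc (len w)
    first (here (q , eq)) = X , suc Y , q + q′ ,
      trans (cong (toℕ x +_) (+-suc (X * k) Y)) (prepend 1 q eq) , trans (+-suc X Y) (cong suc X+Y≡len)
    first (there (here (q , eq))) = suc X , Y , q + q′ ,
      trans (cong (toℕ x +_) (+-assoc k (X * k) Y)) (prepend k q eq) , cong suc X+Y≡len

  displacement-mod : ∀ x y {d Z q} → Displacement x y d → toℕ x + Z ≡ toℕ y + q * n →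
                     ∃ λ μ → Z ≡ d + μ * n
  displacement-mod x y {d} {Z} {q} (_ , inj₁ e) e′ = q , +-cancelˡ-≡ (toℕ x) _ _ (begin
    toℕ x + Z               ≡⟨ e′ ⟩
    toℕ y + q * n           ≡⟨ cong (_+ q * n) e ⟨
    (toℕ x + d) + q * n     ≡⟨ +-assoc (toℕ x) d (q * n) ⟩
    toℕ x + (d + q * n)     ∎)
    where open ≡-Reasoning
  displacement-mod x y {d} {Z} {zero} (d<n , inj₂ e) e′ =
    -- If the cycle must be closed but the walk does not go round, then `d = Z + n`, against
    -- `d < n`.
    contradiction (≤-<-trans (≤-trans (m≤n+m n Z) (≤-reflexive Z+n≡d)) d<n) (<-irrefl refl)
    where
    open ≡-Reasoning
    Z+n≡d : Z + n ≡ d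
    Z+n≡d = +-cancelˡ-≡ (toℕ x) _ _ (begin
      toℕ x + (Z + n)     ≡⟨ +-assoc (toℕ x) Z n ⟨
      (toℕ x + Z) + n     ≡⟨ cong (_+ n) e′ ⟩
      (toℕ y + 0) + n     ≡⟨ cong (_+ n) (+-identityʳ (toℕ y)) ⟩
      toℕ y + n           ≡⟨ e ⟨
      toℕ x + d           ∎)
  displacement-mod x y {d} {Z} {suc q} (_ , inj₂ e) e′ = q , +-cancelˡ-≡ (toℕ x) _ _ (begin
    toℕ x + Z               ≡⟨ e′ ⟩
    toℕ y + (n + q * n)     ≡⟨ +-assoc (toℕ y) n (q * n) ⟨
    (toℕ y + n) + q * n     ≡⟨ cong (_+ q * n) e ⟨
    (toℕ x + d) + q * n     ≡⟨ +-assoc (toℕ x) d (q * n) ⟩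
    toℕ x + (d + q * n)     ∎)
    where open ≡-Reasoning

  -- Each of `μ` additional rounds adds `a` to the quotient by `k` and leaves the remainder alone,
  -- so the cheapest step count can only grow.
  len-≥ : ∀ {x y} q r → r < k → Displacement x y (q * k + r) → (w : Walk G x y) → q + r ≤ len w
  len-≥ {x} {y} q r r<k disp w with walk-steps w
  ... | X , Y , p , e , l with displacement-mod x y {q = p} disp e
  ...   | μ , Z≡ = begin
    q + r               ≤⟨ +-monoˡ-≤ r (m≤m+n q (μ * a)) ⟩
    (q + μ * a) + r     ≤⟨ ≤-div-mod-cost k X Y (q + μ * a) r r<k (trans Z≡ (regroup q μ r a k)) ⟩
    X + Y               ≡⟨ l ⟩
    len w               ∎
    where
    open ≤-Reasoning
    regroup : ∀ q μ r a k → (q * k + r) + μ * (a * k) ≡ (q + μ * a) * k + r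
    regroup = solve-∀

  -- The upper and lower bounds.

  strongly-rainbow : ∀ x y → Σ (Walk G x y) λ w → IsPath w × IsRainbow colouring w × Distance G x y (len w)
  strongly-rainbow x y with displacement x y
  ... | δ , disp@(δ<n , δ-eq)
    with rainbow-route (toℕ x / k) (δ / k) (δ % k) (m%n<n (toℕ x) k) (m<n*o⇒m/o<n δ<n) (m%n<n δ k)
  -- The walk is built between reduced lifts. Bundling it with its properties in `Geodesic` lets one
  -- transport carry everything to `x` and `y`.
  ...   | p , p′ , p+p′≡q , unique with subst₂ Geodesic start≡x end≡y
                                         (walk P ss , walk-isPath P ss end<P+n
                                         , map⁻ (subst Unique (sym (arcColours-walk P ss)) unique)
                                         , trans (len-walk P ss) (trans (length-route p (δ % k) p′) (cong (_+ δ % k) p+p′≡q)))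
    where
    P = toℕ x / k * k + toℕ x % k
    ss = route p (δ % k) p′

    Geodesic : Fin n → Fin n → Set
    Geodesic x y = Σ (Walk G x y) λ w → IsPath w × IsRainbow colouring w × len w ≡ δ / k + δ % k

    P≡x : P ≡ toℕ x
    P≡x = trans (+-comm _ (toℕ x % k)) (sym (m≡m%n+[m/n]*n (toℕ x) k))

    end≡ : end P ss ≡ P + δ
    end≡ = trans (end-route P p (δ % k) p′) (cong (P +_) (begin
      (p + p′) * k + δ % k     ≡⟨ cong (λ q → q * k + δ % k) p+p′≡q ⟩
      δ / k * k + δ % k        ≡⟨ +-comm _ (δ % k) ⟩
      δ % k + δ / k * k        ≡⟨ m≡m%n+[m/n]*n δ k ⟨
      δ                        ∎))
      where open ≡-Reasoning

    end<P+n : end P ss < P + n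
    end<P+n = subst (_< P + n) (sym end≡) (+-monoʳ-< P δ<n)

    start≡x : vertex P ≡ x
    start≡x = vertex≡ P x {0} (trans P≡x (sym (+-identityʳ (toℕ x))))

    end≡y : vertex (end P ss) ≡ y
    end≡y = [ (λ e → vertex≡ _ y {0} (trans end≡ (trans (cong (_+ δ) P≡x) (trans e (sym (+-identityʳ (toℕ y)))))))
            , (λ e → vertex≡ _ y {1} (trans end≡ (trans (cong (_+ δ) P≡x) (trans e (cong (toℕ y +_) (sym (+-identityʳ n)))))))
            ]′ δ-eq
  ...     | w , path , rainbow , len≡ = w , path , rainbow , (w , path , refl) ,
    λ w′ _ → subst (_≤ len w′) (sym len≡) (len-≥ (δ / k) (δ % k) (m%n<n δ k)
      (subst (Displacement x y) (trans (m≡m%n+[m/n]*n δ k) (+-comm (δ % k) _)) disp) w′)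

  -- The vertices 0 and `a′ * k + N = n - 1` are at distance at least `a′ + N = a + B`, and a
  -- rainbow walk cannot have more arcs than there are colours.
  rainbow-lower-bound : ∀ {c} → RainbowConnected G c → a + B ≤ c
  rainbow-lower-bound {c} (f , connected) with connected (vertex 0) (vertex (a′ * k + N)) first≢last
    where
    first≢last : vertex 0 ≢ vertex (a′ * k + N)
    first≢last eq = %-≢ n {0} {a′ * k + N} (≤-trans z<s (m≤n+m N (a′ * k)))
      (subst (a′ * k + N <_) (+-comm (a′ * k) k) (+-monoʳ-< (a′ * k) (n<1+n N)))
      (trans (sym (toℕ-vertex 0)) (trans (cong toℕ eq) (toℕ-vertex (a′ * k + N))))
  ... | w , _ , rainbow = begin
    suc a′ + B                ≡⟨ +-suc a′ B ⟨
    a′ + N                    ≤⟨ len-≥ a′ N (n<1+n N) disp w ⟩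
    len w                     ≡⟨ length-arcColours f w ⟨
    length (arcColours f w)   ≤⟨ Unique⇒length≤ rainbow ⟩
    c                         ∎
    where
    open ≤-Reasoning
    last<n : a′ * k + N < n
    last<n = subst (a′ * k + N <_) (+-comm (a′ * k) k) (+-monoʳ-< (a′ * k) (n<1+n N))
    disp : Displacement (vertex 0) (vertex (a′ * k + N)) (a′ * k + N)
    disp = last<n , inj₁ (trans (cong (_+ (a′ * k + N)) (toℕ-vertex 0))
                                (sym (trans (toℕ-vertex (a′ * k + N)) (m<n⇒m%n≡m last<n))))

strong⇒rainbow : ∀ {n c} {D : Digraph n} → StronglyRainbowConnected D c → RainbowConnected D c
strong⇒rainbow (f , connected) = f , λ x y x≢y →
  let w , path , rainbow , _ = connected x y x≢y in w , path , rainbow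

theorem11 : ∀ (k aₙ : ℕ) → 2 ≤ k ∸ 1 → k ∸ 1 ≤ aₙ →
    src*≡ (Circulant (aₙ * k) (1 ∷ k ∷ [])) (aₙ + k ∸ 2)
    × rc*≡ (Circulant (aₙ * k) (1 ∷ k ∷ [])) (aₙ + k ∸ 2)
theorem11 (suc (suc (suc m))) (suc a′) _ N≤a =
  (strong , λ c c<m s → minimal c c<m (strong⇒rainbow s)) , (strong⇒rainbow strong , minimal)
  where
  open Colouring m a′ N≤a

  a+k∸2≡a+B : a + k ∸ 2 ≡ a + B
  a+k∸2≡a+B = +-∸-assoc a {k} {2} (s≤s (s≤s z≤n))

  strong : StronglyRainbowConnected G (a + k ∸ 2)
  strong = subst (StronglyRainbowConnected G) (sym a+k∸2≡a+B)
                 (colouring , λ x y _ → strongly-rainbow x y)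

  minimal : ∀ c → c < a + k ∸ 2 → ¬ RainbowConnected G c
  minimal c c<m rc = <⇒≱ c<m (subst (_≤ c) (sym a+k∸2≡a+B) (rainbow-lower-bound rc))
theorem11 (suc zero) _ () _
theorem11 (suc (suc zero)) _ (s≤s ()) _
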